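{- Let $G=(V,E,\omega)$ be a directed graph with positive edge weights, $n=|V|$ and $m=|E|$, and let $(u,v,\omega'(u,v))$ be an edge insertion or an edge weight decrease. Since $|S(p(y))|$ is $O(n)$ and both $\|T(u)\|$ and $\|S(v)\|$ are $O(n+m)$, the worst-case complexity of the augmented APSP update algorithm given in the context (Algorithm A) is $O(n^2)$.
   Context: The update $(u,v,\omega'(u,v))$ is either the insertion of an edge $(u,v)$ with weight $\omega'(u,v)$ or a decrease of the weight of the edge $(u,v)$ to $\omega'(u,v)$; $G'=(V,E',\omega')$ is the graph after the update. $d(s,t)$ is the shortest-path distance from $s$ to $t$ in $G$ and $\sigma_{st}$ is the number of shortest paths from $s$ to $t$ in $G$; $d'$ and $\sigma'$ are the corresponding quantities in $G'$. The affected sources of $t$ are $S(t)=\{s\in V: d(s,t)>d'(s,t)\text{ or }\sigma_{st}\neq\sigma'_{st}\}$, and the affected targets of $s$ are $T(s)=\{t\in V: d(s,t)>d'(s,t)\text{ or }\sigma_{st}\neq\sigma'_{st}\}$. The extended size $\|A\|$ of a set of nodes $A$ is the number of nodes in $A$ plus the number of edges that have a node of $A$ as their endpoint. The bound is derived from the running time $\Theta\bigl(\|S(v)\|+\|T(u)\|+\sum_{y\in T(u)}|S(p(y))|\bigr)$ of Algorithm A, where $p(y)$ is the predecessor of $y$ stored by the algorithm. Algorithm A. Input: $G$, the update $(u,v,\omega'(u,v))$, and $d(s,t),\sigma_{st}$ for all $(s,t)\in V^2$. Output: updated $d'(s,t),\sigma'_{st}$ for all $(s,t)\in V^2$. It is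 assumed that initially $d'(s,t)=d(s,t)$ and $\sigma'_{st}=\sigma_{st}$ for all $(s,t)$. Mark all nodes as not visited. If $\omega'(u,v)\le d(u,v)$, do the following. (1) Compute $S(v)$ by a pruned BFS that visits only the nodes of $S(v)$ and their incident edges. (2) Set $d(u,v)\leftarrow\omega'(u,v)$. (3) Let $Q$ be an empty queue; set $p(v)\leftarrow v$, push $v$ into $Q$ and mark $v$ visited. (4) While $Q$ is nonempty, remove its front node $t$ and perform (a) and (b). (a) For each $s\in S(p(t))$: if $d(s,t)\ge d(s,u)+\omega'(u,v)+d(v,t)$, then: if this inequality is strict, set $d'(s,t)\leftarrow d(s,u)+\omega'(u,v)+d(v,t)$ and $\sigma'_{st}\leftarrow 0$; next (in either case) set $\sigma'_{st}\leftarrow\sigma'_{st}+\sigma_{su}\cdot\sigma_{vt}$; and if $t\ne v$, insert $s$ into $S(t)$. (b) For each $w$ with $(t,w)\in E$: if $w$ is not visited and $d(u,w)\ge\omega'(u,v)+d(v,w)$, push $w$ into $Q$, mark $w$ visited and set $p(w)\leftarrow t$. -}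

module Defs where

open import Level using (Level; _⊔_) renaming (suc to lsuc)
open import Algebra.Structures using (IsCommutativeMonoid)
open import Data.Bool.Base using (Bool; true; false; if_then_else_)
open import Data.Fin.Base using (Fin)
open import Data.Fin.Properties using (_≟_)
open import Data.Fin.Subset using (Subset; ∣_∣)
open import Data.Fin.Subset.Properties using (_∈?_)
open import Data.List.Base
  using (List; []; _∷_; _∷ʳ_; allFin; cartesianProduct; filter; length)
open import Data.List.Membership.Propositional using (_∈_)
open import Data.List.Relation.Unary.Unique.Propositional using (Unique)
open import Data.Maybe using (Maybe; just; nothing; Is-just; zipWith)
open import Data.Maybe.Relation.Unary.Any using () renaming (dec to any-dec)
open import Data.Nat.Base as ℕ using (ℕ)
import Data.Nat.Properties as ℕₚ
open import Data.Product using (∃; ∃₂; ∃-syntax; _×_; _,_; uncurry)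
open import Data.Sum using (_⊎_)
open import Data.Unit using (⊤; tt)
open import Data.Vec.Base as Vec using ()
open import Data.Vec.Functional using (Vector; updateAt)
open import Function.Base using (const; id)
open import Function.Bundles using (_⇔_)
open import Relation.Binary.Core using (Rel)
open import Relation.Binary.Structures using (IsDecTotalOrder)
open import Relation.Binary.PropositionalEquality using (_≡_; _≢_)
open import Relation.Nullary using (¬_; Dec; yes; does)
open import Relation.Nullary.Decidable using (¬?; _×-dec_; _⊎-dec_)
open import Relation.Nullary.Construct.Add.Supremum using (_⁺; ⊤⁺; [_])
import Relation.Binary.Construct.Add.Supremum.NonStrict as NonStrict⁺
import Relation.Binary.Construct.Add.Supremum.Strict as Strict⁺
import Relation.Binary.Construct.NonStrictToStrict as ToStrict

-- The numbers in which weights and lengths are measured: any linearly ordered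
-- commutative monoid with strictly monotone addition (ℕ, ℚ, ℝ, …). As in the
-- usual real-RAM model, comparison is an effective operation.
record Weights (c ℓ₁ ℓ₂ : Level) : Set (lsuc (c ⊔ ℓ₁ ⊔ ℓ₂)) where
  infix  4 _≈_ _≤_ _<_
  infixl 6 _+_
  field
    Carrier             : Set c
    _≈_                 : Rel Carrier ℓ₁
    _≤_                 : Rel Carrier ℓ₂
    _+_                 : Carrier → Carrier → Carrier
    0#                  : Carrier
    isDecTotalOrder     : IsDecTotalOrder _≈_ _≤_
    isCommutativeMonoid : IsCommutativeMonoid _≈_ _+_ 0#

  _<_ : Rel Carrier (ℓ₁ ⊔ ℓ₂)
  _<_ = ToStrict._<_ _≈_ _≤_

  field
    +-monoˡ-< : ∀ z {x y} → x < y → x + z < y + z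

------------------------------------------------------------------------
-- Programs with a running time.  `Timed A` is a result together with the
-- number of elementary operations spent on computing it; `step` charges one
-- operation, `return` none.

Timed : ∀ {a} → Set a → Set a
Timed A = ℕ × A

infixl 1 _>>=_

return : ∀ {a} {A : Set a} → A → Timed A
return x = 0 , x

step : ∀ {a} {A : Set a} → A → Timed A
step x = 1 , x

_>>=_ : ∀ {a b} {A : Set a} {B : Set b} → Timed A → (A → Timed B) → Timed B
(k , x) >>= f = let (l , y) = f x in k ℕ.+ l , y

forEach : ∀ {a b} {A : Set a} {B : Set b} →
          List B → (B → A → Timed A) → A → Timed A
forEach []       body x = step x
forEach (b ∷ bs) body x = do
  x ← step x
  x ← body b x
  forEach bs body x

-- The runs of a loop, as the graph of a partial function.  `body x` is
-- `nothing` when the loop is left in the state x.  Every evaluation of the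
-- loop condition costs one operation.
data Loop {a} {A : Set a} (body : A → Maybe (Timed A)) : A → Timed A → Set a where
  exit    : ∀ {x} → body x ≡ nothing → Loop body x (1 , x)
  iterate : ∀ {x y z k l} → body x ≡ just (k , y) → Loop body y (l , z) →
            Loop body x (1 ℕ.+ k ℕ.+ l , z)

-- Assignment to one cell of an array or of a matrix.

_[_≔_] : ∀ {a} {A : Set a} {n} → Vector A n → Fin n → A → Vector A n
xs [ i ≔ x ] = updateAt xs i (const x)

_⟦_,_≔_⟧ : ∀ {a} {A : Set a} {m n} →
           Vector (Vector A n) m → Fin m → Fin n → A → Vector (Vector A n) m
xs ⟦ i , j ≔ x ⟧ = updateAt xs i (_[ j ≔ x ])

------------------------------------------------------------------------

module APSP {c ℓ₁ ℓ₂} (W : Weights c ℓ₁ ℓ₂) where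

  open Weights W
  open IsDecTotalOrder isDecTotalOrder using (_≤?_) renaming (_≟_ to _≈?_)
  open NonStrict⁺ _≤_ using (_≤⁺_; ≤⁺-dec)
  open Strict⁺ _<_ using (_<⁺_; <⁺-dec)

  -- Lengths and distances, with ⊤⁺ as ∞.
  Length : Set c
  Length = Carrier ⁺

  infix  4 _≤⁺?_ _<⁺?_
  infixl 6 _⊕_

  _⊕_ : Length → Length → Length
  _⊕_ = zipWith _+_

  _≤⁺?_ : (x y : Length) → Dec (x ≤⁺ y)
  _≤⁺?_ = ≤⁺-dec _≤?_

  _<⁺?_ : (x y : Length) → Dec (x <⁺ y)
  _<⁺?_ = <⁺-dec (ToStrict.<-decidable _≈_ _≤_ _≈?_ _≤?_)

  -- The node set is Fin n; ω x y is `nothing` when (x , y) is not an edge.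
  record Graph (n : ℕ) : Set (c ⊔ ℓ₁ ⊔ ℓ₂) where
    field
      ω        : Fin n → Fin n → Maybe Carrier
      positive : ∀ {x y w} → ω x y ≡ just w → 0# < w

    E : Rel (Fin n) c
    E x y = Is-just (ω x y)

    E? : ∀ x y → Dec (E x y)
    E? x y = any-dec (λ _ → yes tt) (ω x y)

    edges : List (Fin n × Fin n)
    edges = filter (uncurry E?) (cartesianProduct (allFin n) (allFin n))

    m : ℕ
    m = length edges

    outNeighbours inNeighbours : Fin n → List (Fin n)
    outNeighbours x = filter (E? x) (allFin n)
    inNeighbours  y = filter (λ x → E? x y) (allFin n)

    -- Extended size of a set of nodes.
    ∥_∥ : Subset n → ℕ
    ∥ A ∥ = ∣ A ∣ ℕ.+
      length (filter (λ (x , y) → (x ∈? A) ⊎-dec (y ∈? A)) edges)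

    -- IsPath s t p ℓ: the node sequence p, both ends included, is a path from
    -- s to t of length ℓ.  Nodes may repeat; since weights are positive, this
    -- affects neither the distances nor the set of shortest paths.
    data IsPath : Fin n → Fin n → List (Fin n) → Carrier → Set c where
      stop : ∀ {s} → IsPath s s (s ∷ []) 0#
      edge : ∀ {s x t p w ℓ} → ω s x ≡ just w → IsPath x t p ℓ →
             IsPath s t (s ∷ p) (w + ℓ)

    IsMinimal : Fin n → Fin n → Carrier → Set (c ⊔ ℓ₂)
    IsMinimal s t ℓ = ∀ {p ℓ′} → IsPath s t p ℓ′ → ℓ ≤ ℓ′

    IsShortestPath : Fin n → Fin n → List (Fin n) → Set (c ⊔ ℓ₂)
    IsShortestPath s t p = ∃[ ℓ ] IsPath s t p ℓ × IsMinimal s t ℓ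

    data IsDistance (s t : Fin n) : Length → Set (c ⊔ ℓ₁ ⊔ ℓ₂) where
      reachable   : ∀ {p ℓ δ} → IsPath s t p ℓ → IsMinimal s t ℓ → δ ≈ ℓ →
                    IsDistance s t [ δ ]
      unreachable : (∀ {p ℓ} → ¬ IsPath s t p ℓ) → IsDistance s t ⊤⁺

    IsPathCount : Fin n → Fin n → ℕ → Set (c ⊔ ℓ₂)
    IsPathCount s t k = ∃[ ps ]
      Unique ps × (∀ p → p ∈ ps ⇔ IsShortestPath s t p) × length ps ≡ k

  record IsAPSP {n} (G : Graph n) (d : Vector (Vector Length n) n)
                (σ : Vector (Vector ℕ n) n) : Set (c ⊔ ℓ₁ ⊔ ℓ₂) where
    open Graph G
    field
      distance : ∀ s t → IsDistance s t (d s t)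
      count    : ∀ s t → IsPathCount s t (σ s t)

  module _ {n} (G : Graph n) (u v : Fin n) (ω′uv : Carrier) where
    open Graph G

    data IsUpdate : Set (c ⊔ ℓ₁ ⊔ ℓ₂) where
      insertion : ω u v ≡ nothing → 0# < ω′uv → IsUpdate
      decrease  : ∀ {w} → ω u v ≡ just w → ω′uv < w → 0# < ω′uv → IsUpdate

    -- G′ is the graph after the update.
    IsUpdated : Graph n → Set c
    IsUpdated G′ = ∀ x y → Graph.ω G′ x y ≡ (ω ⟦ u , v ≔ just ω′uv ⟧) x y

  module Affected {n} (d d′ : Vector (Vector Length n) n)
                  (σ σ′ : Vector (Vector ℕ n) n) where

    IsAffected : Fin n → Fin n → Set (c ⊔ ℓ₁ ⊔ ℓ₂)
    IsAffected s t = d′ s t <⁺ d s t ⊎ σ s t ≢ σ′ s t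

    isAffected? : ∀ s t → Dec (IsAffected s t)
    isAffected? s t = (d′ s t <⁺? d s t) ⊎-dec ¬? (σ s t ℕₚ.≟ σ′ s t)

    S T : Fin n → Subset n
    S t = Vec.tabulate (λ s → does (isAffected? s t))
    T s = Vec.tabulate (λ t → does (isAffected? s t))

  ----------------------------------------------------------------------
  -- The algorithm.  Charged as one elementary operation: a comparison (with
  -- the constantly many sums and look-ups in it), an assignment to an array
  -- cell, an insertion into a queue or into a set S(t), and each test of a
  -- loop condition.  Graphs are given by adjacency lists in both directions.

  module AlgorithmA {n} (G : Graph n) (u v : Fin n) (ω′uv : Carrier)
                    (d : Vector (Vector Length n) n)
                    (σ : Vector (Vector ℕ n) n) where
    open Graph G

    record State : Set c where
      field
        d′      : Vector (Vector Length n) n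
        σ′      : Vector (Vector ℕ n) n
        S       : Vector (List (Fin n)) n
        p       : Vector (Fin n) n
        visited : Vector Bool n
        Q       : List (Fin n)
    open State

    -- The values of p before its assignments are never read.
    initial : State
    initial = record
      { d′ = d ; σ′ = σ ; S = const [] ; p = id ; visited = const false ; Q = [] }

    -- Step (1): breadth-first search from u along reversed edges.  A node x
    -- with d(x,u) < ∞ is in S(v) iff d(x,u) + ω′(u,v) ≤ d(x,v), and every node
    -- on a shortest path from such an x to u satisfies this as well.
    record Search : Set where
      field
        found : List (Fin n)
        seen  : Vector Bool n
        queue : List (Fin n)
    open Search

    scanIn : Fin n → Search → Timed Search
    scanIn x b = do
      false ← step (seen b x)
        where true → return b
      true ← step (does (d x u ⊕ [ ω′uv ] ≤⁺? d x v))
        where false → return b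
      b ← step (record b { queue = queue b ∷ʳ x })
      step (record b { seen = seen b [ x ≔ true ] })

    visitSource : Search → Maybe (Timed Search)
    visitSource b with queue b
    ... | []    = nothing
    ... | s ∷ q = just (do
      b ← step (record b { queue = q })
      b ← step (record b { found = s ∷ found b })
      forEach (inNeighbours s) scanIn b)

    startSearch : Search
    startSearch = record
      { found = [] ; seen = const false [ u ≔ true ] ; queue = u ∷ [] }

    -- Step (2).
    d₂ : Vector (Vector Length n) n
    d₂ = d ⟦ u , v ≔ [ ω′uv ] ⟧

    -- Step (4a) for one s.
    updateSource : Fin n → Fin n → State → Timed State
    updateSource t s a = do
      let new = d₂ s u ⊕ [ ω′uv ] ⊕ d₂ v t
      true ← step (does (new ≤⁺? d₂ s t))
        where false → return a
      strict ← step (does (new <⁺? d₂ s t))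
      a ← if strict
          then (do a ← step (record a { d′ = d′ a ⟦ s , t ≔ new ⟧ })
                   step (record a { σ′ = σ′ a ⟦ s , t ≔ 0 ⟧ }))
          else return a
      a ← step (record a { σ′ = σ′ a ⟦ s , t ≔ σ′ a s t ℕ.+ σ s u ℕ.* σ v t ⟧ })
      false ← step (does (t ≟ v))
        where true → return a
      step (record a { S = S a [ t ≔ s ∷ S a t ] })

    -- Step (4b) for one w.
    scanOut : Fin n → Fin n → State → Timed State
    scanOut t w a = do
      false ← step (visited a w)
        where true → return a
      true ← step (does ([ ω′uv ] ⊕ d₂ v w ≤⁺? d₂ u w))
        where false → return a
      a ← step (record a { Q = Q a ∷ʳ w })
      a ← step (record a { visited = visited a [ w ≔ true ] })
      step (record a { p = p a [ w ≔ t ] })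

    visitTarget : State → Maybe (Timed State)
    visitTarget a with Q a
    ... | []    = nothing
    ... | t ∷ q = just (do
      a ← step (record a { Q = q })
      a ← forEach (S a (p a t)) (updateSource t) a
      forEach (outNeighbours t) (scanOut t) a)

    -- The state after step (3), if step (1) found the list S(v).
    startTargets : List (Fin n) → State
    startTargets Sv = record initial
      { S = S initial [ v ≔ Sv ] ; p = p initial [ v ≔ v ]
      ; visited = visited initial [ v ≔ true ] ; Q = v ∷ [] }

    -- Runs (k , a): the algorithm halts in the state a after k operations.
    -- 3n of them mark all nodes as not visited, in the main loop and in the
    -- search, and make the sets S(t) empty; 1 is for ω′(u,v) ≤ d(u,v); 2 for
    -- starting the search; 1 is for storing S(v); 1 for step (2); and 4 for
    -- step (3).
    data Runs : Timed State → Set (c ⊔ ℓ₁ ⊔ ℓ₂) where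
      skip   : ¬ ([ ω′uv ] ≤⁺ d u v) → Runs (3 ℕ.* n ℕ.+ 1 , initial)
      update : ∀ {k l b a} → [ ω′uv ] ≤⁺ d u v →
               Loop visitSource startSearch (k , b) →
               Loop visitTarget (startTargets (found b)) (l , a) →
               Runs (3 ℕ.* n ℕ.+ 1 ℕ.+ (2 ℕ.+ k ℕ.+ 1) ℕ.+ 1 ℕ.+ (4 ℕ.+ l) , a)

{-# OPTIONS --safe #-}
module Submission where

-- In both breadth-first searches a node is marked when it enters the queue, so
-- the number of unmarked nodes plus the length of the queue drops by one in
-- every round: there are at most n rounds. One round scans a neighbourhood and,
-- in the main loop, also a set S(p(t)). The latter has at most n elements:
-- S(v) lists the nodes removed from the queue of the first search, and for
-- t ≠ v the set S(t) is empty until t is removed from the queue (which happens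
-- once) and then receives at most one node for each node of S(p(t)).

open import Defs
open import Data.Bool.Base using (Bool; true; false; if_then_else_)
open import Data.Fin.Base using (Fin; zero; suc)
open import Data.Fin.Properties using (_≟_)
open import Data.Fin.Subset using (Subset; _∈_; ∣_∣)
open import Data.Fin.Subset.Properties using (∣p∣≤n)
open import Data.List.Base using (List; []; _∷_; _∷ʳ_; allFin; filter; length)
import Data.List.Membership.Propositional as List
open import Data.List.Membership.Propositional.Properties using (∈-++⁻)
open import Data.List.Properties using (length-++; length-filter; length-tabulate)
open import Data.List.Relation.Unary.All using ([]; lookup)
open import Data.List.Relation.Unary.AllPairs as AllPairs using ([]; _∷_)
open import Data.List.Relation.Unary.Any using (here; there)
open import Data.List.Relation.Unary.Unique.Propositional using (Unique)
import Data.List.Relation.Unary.Unique.Propositional.Properties as Unique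
open import Data.Maybe.Base using (Maybe; just; nothing)
open import Data.Nat.Base using (ℕ; zero; suc; _+_; _*_; _^_; _≤_; _<_; z≤n; s≤s)
open import Data.Nat.Induction using (Acc; acc; <-wellFounded)
open import Data.Nat.Properties
  using ( ≤-refl; ≤-reflexive; ≤-trans; +-mono-≤; +-monoˡ-≤; +-monoʳ-≤; *-mono-≤
        ; *-monoˡ-≤; *-monoʳ-≤; +-suc; +-comm; m≤m+n; m≤n+m
        ; m≤n*m; module ≤-Reasoning)
open import Data.Nat.Tactic.RingSolver using (solve-∀)
open import Data.Product using (∃; ∃-syntax; _×_; _,_; proj₁; proj₂)
open import Data.Sum using (_⊎_; inj₁; inj₂; [_,_]′; map)
open import Data.Vec.Functional using (Vector; head; tail)
open import Data.Vec.Functional.Properties using (updateAt-updates; updateAt-minimal)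
open import Function.Base using (const; _∘_)
open import Relation.Binary.PropositionalEquality
  using (_≡_; _≢_; refl; sym; trans; cong; cong₂; cong-app; subst)
open import Relation.Nullary using (¬_; Dec; yes; no; does; contradiction)
open import Relation.Nullary.Construct.Add.Supremum using ([_])

-- Running times of loops

module _ {a b} {A : Set a} {B : Set b} {body : B → A → Timed A}
         {p} (P : ℕ → A → Set p) {K : ℕ}
         (preserved : ∀ {j} b {x} → P (suc j) x →
                      proj₁ (body b x) ≤ K × P j (proj₂ (body b x))) where

  -- The index of P is the number of rounds that remain.
  forEach-time : ∀ bs {x} → P (length bs) x →
                 proj₁ (forEach bs body x) ≤ 1 + length bs * (1 + K)
                 × P 0 (proj₂ (forEach bs body x))
  forEach-time []       Px = ≤-refl , Px
  forEach-time (b ∷ bs) {x} Px with preserved b Px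
  ... | k≤K , Py with forEach-time bs Py
  ... | l≤ , Pz = time , Pz
    where
    open ≤-Reasoning
    time : proj₁ (forEach (b ∷ bs) body x) ≤ 1 + suc (length bs) * (1 + K)
    time = begin
      1 + (proj₁ (body b x) + proj₁ (forEach bs body (proj₂ (body b x))))
        ≤⟨ s≤s (+-mono-≤ k≤K l≤) ⟩
      1 + (K + (1 + length bs * (1 + K)))
        ≡⟨ cong suc (+-suc K _) ⟩
      1 + suc (length bs) * (1 + K) ∎

module _ {a} {A : Set a} {body : A → Maybe (Timed A)}
         {i} (I : A → Set i) (potential : A → ℕ) {K : ℕ}
         (progress : ∀ {x k y} → body x ≡ just (k , y) → I x →
                     k ≤ K × I y × potential y < potential x) where

  -- `Loop` is only the graph of a partial function, so the existence of a run needs its own proof: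
  -- well-founded recursion on the potential.
  loop-halts : ∀ {x} → I x → ∃ (Loop body x)
  loop-halts Ix = go Ix (<-wellFounded _)
    where
    go : ∀ {x} → I x → Acc _<_ (potential x) → ∃ (Loop body x)
    go {x} Ix (acc rs) with body x in eq
    ... | nothing = _ , exit eq
    ... | just (k , y) with progress eq Ix
    ... | _ , Iy , y<x = _ , iterate eq (proj₂ (go Iy (rs y<x)))

  -- A strictly falling potential allows at most `potential x` rounds. Each costs `K` plus one test
  -- of the loop condition; the leading 1 is the test that ends the loop.
  loop-time : ∀ {x k z} → I x → Loop body x (k , z) →
              k ≤ 1 + potential x * (1 + K) × I z
  loop-time Ix (exit _) = s≤s z≤n , Ix
  loop-time {x} Ix (iterate {y = y} {k = k} {l = l} eq run) with progress eq Ix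
  ... | k≤K , Iy , y<x with loop-time Iy run
  ... | l≤ , Iz = time , Iz
    where
    open ≤-Reasoning
    time : 1 + k + l ≤ 1 + potential x * (1 + K)
    time = begin
      1 + k + l                              ≤⟨ s≤s (+-mono-≤ k≤K l≤) ⟩
      1 + (K + (1 + potential y * (1 + K)))  ≡⟨ cong suc (+-suc K _) ⟩
      1 + suc (potential y) * (1 + K)        ≤⟨ s≤s (*-monoˡ-≤ (1 + K) y<x) ⟩
      1 + potential x * (1 + K)              ∎

-- Marked nodes

unmarked : ∀ {n} → Vector Bool n → ℕ
unmarked {zero}  marks = 0
unmarked {suc n} marks = (if head marks then 0 else 1) + unmarked (tail marks)

unmarked-none : ∀ n → unmarked {n} (const false) ≡ n
unmarked-none zero    = refl
unmarked-none (suc n) = cong suc (unmarked-none n)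

unmarked-mark : ∀ {n} (marks : Vector Bool n) i → marks i ≡ false →
                suc (unmarked (marks [ i ≔ true ])) ≡ unmarked marks
unmarked-mark marks zero    eq rewrite eq = refl
unmarked-mark marks (suc i) eq =
  trans (sym (+-suc h _)) (cong (h +_) (unmarked-mark (tail marks) i eq))
  where h = if head marks then 0 else 1

mark-keeps : ∀ {n} (marks : Vector Bool n) i {j} → marks j ≡ true →
             (marks [ i ≔ true ]) j ≡ true
mark-keeps marks i {j} eq with j ≟ i
... | yes refl = updateAt-updates i marks
... | no  j≢i  = trans (updateAt-minimal j i marks j≢i) eq

mark-reflects : ∀ {n} (marks : Vector Bool n) i {j} →
                (marks [ i ≔ true ]) j ≡ false → marks j ≡ false
mark-reflects marks i {j} eq with marks j in eq′
... | false = refl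
... | true  = contradiction (trans (sym eq) (mark-keeps marks i eq′)) λ ()

length-∷ʳ : ∀ {a} {A : Set a} (xs : List A) {x} → length (xs ∷ʳ x) ≡ suc (length xs)
length-∷ʳ xs = trans (length-++ xs) (+-comm (length xs) 1)

-- The queue gains what the unmarked nodes lose. Scanning neighbours thus preserves the potential of
-- either search; only removal from the queue lowers it.
enqueue-mark : ∀ {n} (q : List (Fin n)) (marks : Vector Bool n) i → marks i ≡ false →
               length (q ∷ʳ i) + unmarked (marks [ i ≔ true ]) ≡ length q + unmarked marks
enqueue-mark q marks i eq rewrite length-∷ʳ q {i} | sym (unmarked-mark marks i eq) =
  sym (+-suc (length q) _)

-- Bounds in terms of the number of nodes

filter-allFin≤n : ∀ {n p} {P : Fin n → Set p} (P? : ∀ x → Dec (P x)) →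
                  length (filter P? (allFin n)) ≤ n
filter-allFin≤n {n} P? =
  ≤-trans (length-filter P? (allFin n)) (≤-reflexive (length-tabulate _))

-- The element of `Fin n` rules out `n = 0`, where 11 would exceed the right-hand side. Otherwise 11
-- and `11 * n` are each at most `11 * (n * n)`, and 41 = 11 + 11 + 19.
quadratic-dominates : ∀ n → Fin n → 11 + 11 * n + 19 * (n * n) ≤ 41 * n ^ 2
quadratic-dominates n@(suc _) _ = begin
  11 + 11 * n + 19 * (n * n)
    ≤⟨ +-monoˡ-≤ (19 * (n * n)) (+-mono-≤ (*-monoʳ-≤ 11 (*-mono-≤ 1≤n 1≤n))
                                           (*-monoʳ-≤ 11 (m≤n*m n n))) ⟩
  11 * (n * n) + 11 * (n * n) + 19 * (n * n)
    ≡⟨ collect n ⟩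
  41 * n ^ 2 ∎
  where
  open ≤-Reasoning
  1≤n : 1 ≤ n
  1≤n = s≤s z≤n
  collect : ∀ n → 11 * (n * n) + 11 * (n * n) + 19 * (n * n) ≡ 41 * (n * (n * 1))
  collect = solve-∀

module _ {c ℓ₁ ℓ₂} (W : Weights c ℓ₁ ℓ₂) where
  open APSP W

  extendedSize≤ : ∀ {n} (G : Graph n) (A : Subset n) →
                  Graph.∥_∥ G A ≤ n + Graph.m G
  extendedSize≤ G A = +-mono-≤ (∣p∣≤n A) (length-filter _ (Graph.edges G))

  module _ {n} (G : Graph n) (u v : Fin n) (ω′uv : Weights.Carrier W)
           (d : Vector (Vector Length n) n) (σ : Vector (Vector ℕ n) n) where
    open Graph G
    open AlgorithmA G u v ω′uv d σ

    -- Step (1)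

    module _ where
      open Search

      searchPotential : Search → ℕ
      searchPotential b = length (queue b) + unmarked (seen b)

      -- A round moves one node from the queue to `found`, so the sum does not grow. Including
      -- `length (found b)` bounds the list computed for S(v) without characterising its elements.
      SearchInvariant : Search → Set
      SearchInvariant b = length (found b) + searchPotential b ≤ n

      scanIn-time : ∀ x b → let (k , b′) = scanIn x b in
                    k ≤ 4 × found b′ ≡ found b × searchPotential b′ ≡ searchPotential b
      scanIn-time x b with seen b x in eq
      ... | true = s≤s z≤n , refl , refl
      ... | false with does (d x u ⊕ [ ω′uv ] ≤⁺? d x v)
      ... | false = s≤s (s≤s z≤n) , refl , refl
      -- Two tests, the push and the marking make 4.
      ... | true  = ≤-refl , refl , enqueue-mark (queue b) (seen b) x eq

      scanAllIn-time : ∀ xs b → let (k , b′) = forEach xs scanIn b in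
                       k ≤ 1 + length xs * 5
                       × found b′ ≡ found b × searchPotential b′ ≡ searchPotential b
      scanAllIn-time xs b =
        forEach-time {body = scanIn}
          (λ _ b′ → found b′ ≡ found b × searchPotential b′ ≡ searchPotential b)
          (λ x {b′} (f , e) → let (t , f′ , e′) = scanIn-time x b′ in
                              t , trans f′ f , trans e′ e)
          xs (refl , refl)

      visitSource-progress : ∀ {b k b′} → visitSource b ≡ just (k , b′) →
                             SearchInvariant b →
                             k ≤ 3 + n * 5 × SearchInvariant b′
                             × searchPotential b′ < searchPotential b
      visitSource-progress {b} eq inv with queue b
      visitSource-progress {b} refl inv | s ∷ q
        with scanAllIn-time (inNeighbours s)
               record { found = s ∷ found b ; seen = seen b ; queue = q }
      ... | t , f , e =
          -- The 3 counts the removal from the queue, the insertion into `found` and the closing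
          -- test of the neighbour loop; each neighbour costs 4 and one test.
          s≤s (s≤s (≤-trans t (s≤s (*-monoˡ-≤ 5 (filter-allFin≤n (λ x → E? x s))))))
        , ≤-trans (≤-reflexive (trans (cong₂ (λ xs l → length xs + l) f e)
                                      (sym (+-suc (length (found b)) _))))
                  inv
        , s≤s (≤-reflexive e)

      searchPotential-start : searchPotential startSearch ≡ n
      searchPotential-start =
        trans (unmarked-mark (const false) u refl) (unmarked-none n)

      search-start : SearchInvariant startSearch
      search-start = ≤-reflexive searchPotential-start

      search-halts : ∃ (Loop visitSource startSearch)
      search-halts =
        loop-halts SearchInvariant searchPotential visitSource-progress search-start

      search-time : ∀ {k b} → Loop visitSource startSearch (k , b) →
                    k ≤ 1 + n * (4 + n * 5) × length (found b) ≤ n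
      search-time run
        with loop-time SearchInvariant searchPotential visitSource-progress
                       search-start run
      ... | t , inv =
          subst (λ m → _ ≤ 1 + m * (4 + n * 5)) searchPotential-start t
        , ≤-trans (m≤m+n _ _) inv

    -- Steps (3) and (4)

    open State

    potential : State → ℕ
    potential a = length (Q a) + unmarked (visited a)

    -- `S-bounded` yields the running time; the other fields serve to maintain it. `pending-S`
    -- excepts `v` because S(v) is filled before the loop. `queue-visited` and `queue-unique` ensure
    -- that a node removed from the queue is no longer pending.
    record Invariant (a : State) : Set c where
      field
        queue-visited : ∀ {x} → x List.∈ Q a → visited a x ≡ true
        queue-unique  : Unique (Q a)
        pending-S     : ∀ {x} → x ≢ v → visited a x ≡ false ⊎ x List.∈ Q a → S a x ≡ []
        S-bounded     : ∀ x → length (S a x) ≤ n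
    open Invariant

    -- Step (4a) leads from a to a′ and has j more rounds to go. The second
    -- alternative in same-S: if t = v, then nothing is inserted into S(t).
    record Sources (t : Fin n) (a : State) (N j : ℕ) (a′ : State) : Set c where
      field
        same-Q       : Q a′ ≡ Q a
        same-visited : visited a′ ≡ visited a
        same-S       : ∀ {x} → x ≢ t ⊎ t ≡ v → S a′ x ≡ S a x
        S-length     : length (S a′ t) + j ≤ N
    open Sources

    -- The equations concern only the fields that `Sources` mentions, so `refl` covers every branch
    -- without an insertion, whatever happens to `d′` and `σ′`. The allowance of one insertion for
    -- this round is forgone.
    keep-S : ∀ {t a N j a′ a″} → Q a″ ≡ Q a′ → visited a″ ≡ visited a′ → S a″ ≡ S a′ →
             Sources t a N (suc j) a′ → Sources t a N j a″
    keep-S {j = j} refl refl refl r = record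
      { same-Q = same-Q r ; same-visited = same-visited r ; same-S = same-S r
      ; S-length = ≤-trans (+-monoʳ-≤ _ (m≤n+m j 1)) (S-length r) }

    extend-S : ∀ {t a N j a′ a″} s → t ≢ v → Q a″ ≡ Q a′ → visited a″ ≡ visited a′ →
               S a″ ≡ S a′ [ t ≔ s ∷ S a′ t ] →
               Sources t a N (suc j) a′ → Sources t a N j a″
    extend-S {t} {N = N} {j} {a′} s t≢v refl refl refl r = record
      { same-Q = same-Q r ; same-visited = same-visited r
      ; same-S = λ where
          (inj₁ x≢t) → trans (updateAt-minimal _ t (S a′) x≢t) (same-S r (inj₁ x≢t))
          (inj₂ t≡v) → contradiction t≡v t≢v
      -- The insertion spends the allowance of one round, so length plus remaining rounds stays the
      -- same.
      ; S-length = subst (λ xs → length xs + j ≤ N) (sym (updateAt-updates t (S a′)))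
                         (subst (_≤ N) (+-suc _ j) (S-length r)) }

    updateSource-time : ∀ {t a N j} s {a′} → Sources t a N (suc j) a′ →
                        let (k , a″) = updateSource t s a′ in
                        k ≤ 7 × Sources t a N j a″
    updateSource-time {t} s {a′} r
      with does (d₂ s u ⊕ [ ω′uv ] ⊕ d₂ v t ≤⁺? d₂ s t)
    ... | false = s≤s z≤n , keep-S refl refl refl r
    ... | true with does (d₂ s u ⊕ [ ω′uv ] ⊕ d₂ v t <⁺? d₂ s t) | t ≟ v
    ... | true  | yes _  = m≤m+n 6 1 , keep-S refl refl refl r
    ... | false | yes _  = m≤m+n 4 3 , keep-S refl refl refl r
    -- The costliest branch: three tests, the two resets, the addition to `σ′` and the insertion
    -- make 7.
    ... | true  | no t≢v = ≤-refl , extend-S s t≢v refl refl refl r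
    ... | false | no t≢v = m≤m+n 5 2 , extend-S s t≢v refl refl refl r

    scanOut-time : ∀ t w a → Invariant a → let (k , a′) = scanOut t w a in
                   k ≤ 5 × Invariant a′ × potential a′ ≡ potential a
    scanOut-time t w a inv with visited a w in eq
    ... | true = s≤s z≤n , inv , refl
    ... | false with does ([ ω′uv ] ⊕ d₂ v w ≤⁺? d₂ u w)
    ... | false = m≤m+n 2 3 , inv , refl
    ... | true  = ≤-refl , inv′ , enqueue-mark (Q a) (visited a) w eq
      where
      unvisited∉Q : ¬ w List.∈ Q a
      unvisited∉Q w∈Q = contradiction (trans (sym eq) (queue-visited inv w∈Q)) λ ()

      enqueued : ∀ {x} → x List.∈ Q a ∷ʳ w → x List.∈ Q a ⊎ x ≡ w
      enqueued x∈ with ∈-++⁻ (Q a) x∈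
      ... | inj₁ x∈Q        = inj₁ x∈Q
      ... | inj₂ (here x≡w) = inj₂ x≡w

      inv′ : Invariant _
      inv′ = record
        { queue-visited = λ x∈ → [ mark-keeps (visited a) w ∘ queue-visited inv
                                 , (λ { refl → updateAt-updates w (visited a) })
                                 ]′ (enqueued x∈)
        ; queue-unique  = Unique.++⁺ (queue-unique inv) ([] ∷ [])
                            λ { (x∈Q , here refl) → unvisited∉Q x∈Q }
        ; pending-S     = λ where
            x≢v (inj₁ x∉) → pending-S inv x≢v (inj₁ (mark-reflects (visited a) w x∉))
            x≢v (inj₂ x∈) → [ pending-S inv x≢v ∘ inj₂
                            -- The new entry `w` was unvisited, so its set was already known to be
                            -- empty.
                            , (λ { refl → pending-S inv x≢v (inj₁ eq) })
                            ]′ (enqueued x∈)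
        ; S-bounded     = S-bounded inv
        }

    updateSources-time : ∀ t ss a → let (k , a′) = forEach ss (updateSource t) a in
                         k ≤ 1 + length ss * 8
                         × Sources t a (length (S a t) + length ss) 0 a′
    updateSources-time t ss a =
      forEach-time {body = updateSource t}
        (Sources t a (length (S a t) + length ss)) updateSource-time ss
        (record { same-Q = refl ; same-visited = refl
                ; same-S = λ _ → refl ; S-length = ≤-refl })

    scanAllOut-time : ∀ t ws a → Invariant a → let (k , a′) = forEach ws (scanOut t) a in
                      k ≤ 1 + length ws * 6 × Invariant a′ × potential a′ ≡ potential a
    scanAllOut-time t ws a inv =
      forEach-time {body = scanOut t}
        (λ _ a′ → Invariant a′ × potential a′ ≡ potential a)
        (λ w {a′} (inv′ , e) → let (k≤ , inv″ , e′) = scanOut-time t w a′ inv′ in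
                               k≤ , inv″ , trans e′ e)
        ws (inv , refl)

    -- Filling S(t) is compatible with `pending-S`: once removed, `t` is visited and, the queue
    -- having no duplicates, no longer queued.
    updateSources-invariant : ∀ {t q a a′ N} → Q a ≡ t ∷ q → Invariant a → N ≤ n →
      Sources t (record a { Q = q }) (length (S a t) + N) 0 a′ →
      Invariant a′ × suc (potential a′) ≡ potential a
    updateSources-invariant {t} {q} {a} {a′} {N} Qa≡ inv N≤n r = inv′ , smaller
      where
      smaller : suc (potential a′) ≡ potential a
      smaller rewrite same-Q r | same-visited r | Qa≡ = refl

      still-queued : ∀ {x} → x List.∈ Q a′ → x List.∈ Q a
      still-queued x∈ = subst (_ List.∈_) (sym Qa≡) (there (subst (_ List.∈_) (same-Q r) x∈))

      t∈Q : t List.∈ Q a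
      t∈Q = subst (t List.∈_) (sym Qa≡) (here refl)

      unique : Unique (t ∷ q)
      unique = subst Unique Qa≡ (queue-unique inv)

      t-processed : ¬ (visited a′ t ≡ false ⊎ t List.∈ Q a′)
      t-processed (inj₁ unvisited) = contradiction
        (trans (sym unvisited) (trans (cong-app (same-visited r) t) (queue-visited inv t∈Q)))
        λ ()
      t-processed (inj₂ t∈) with t∉q ∷ _ ← unique =
        lookup t∉q (subst (t List.∈_) (same-Q r) t∈) refl

      pending : ∀ {x} → x ≢ v → visited a′ x ≡ false ⊎ x List.∈ Q a′ → S a′ x ≡ []
      pending {x} x≢v p with x ≟ t
      ... | yes refl = contradiction p t-processed
      ... | no x≢t   = trans (same-S r (inj₁ x≢t)) (pending-S inv x≢v
        (map (trans (cong-app (sym (same-visited r)) x)) still-queued p))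

      -- Only S(t) can change, and not even that if `t ≡ v`. For `t ≢ v` it was empty before, so at
      -- most `N` insertions fill it.
      bounded : ∀ x → length (S a′ x) ≤ n
      bounded x with x ≟ t | t ≟ v
      ... | no x≢t   | _       rewrite same-S r (inj₁ x≢t) = S-bounded inv x
      ... | yes refl | yes t≡v rewrite same-S r {t} (inj₂ t≡v) = S-bounded inv t
      ... | yes refl | no t≢v  = begin
        length (S a′ t)      ≤⟨ m≤m+n _ 0 ⟩
        length (S a′ t) + 0  ≤⟨ S-length r ⟩
        length (S a t) + N   ≡⟨ cong (λ xs → length xs + N) (pending-S inv t≢v (inj₂ t∈Q)) ⟩
        N                    ≤⟨ N≤n ⟩
        n                    ∎
        where open ≤-Reasoning

      inv′ : Invariant a′
      inv′ = record
        { queue-visited = λ x∈ → trans (cong-app (same-visited r) _)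
                                       (queue-visited inv (still-queued x∈))
        ; queue-unique  = subst Unique (sym (same-Q r)) (AllPairs.tail unique)
        ; pending-S     = pending
        ; S-bounded     = bounded
        }

    visitTarget-progress : ∀ {a k a′} → visitTarget a ≡ just (k , a′) → Invariant a →
                           k ≤ 3 + n * 14 × Invariant a′ × potential a′ < potential a
    visitTarget-progress {a} eq inv with Q a in Qa≡
    visitTarget-progress {a} refl inv | t ∷ q
      with updateSources-time t (S a (p a t)) (record a { Q = q })
    ... | k≤ , r with updateSources-invariant Qa≡ inv (S-bounded inv (p a t)) r
    ... | inv₁ , e₁ with scanAllOut-time t (outNeighbours t) _ inv₁
    ... | l≤ , inv₂ , e₂ =
        -- The 3 counts the removal from the queue and the closing tests of the two inner loops; 14
        -- = (7 + 1) + (5 + 1), each 1 being a loop test.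
        s≤s time , inv₂
      , ≤-reflexive (trans (cong suc e₂)
          (trans e₁ (cong (λ xs → length xs + unmarked (visited a)) Qa≡)))
      where
      open ≤-Reasoning
      time = begin
        _ ≤⟨ +-mono-≤ k≤ l≤ ⟩
        (1 + length (S a (p a t)) * 8) + (1 + length (outNeighbours t) * 6)
          ≤⟨ +-mono-≤ (s≤s (*-monoˡ-≤ 8 (S-bounded inv (p a t))))
                      (s≤s (*-monoˡ-≤ 6 (filter-allFin≤n (E? t)))) ⟩
        (1 + n * 8) + (1 + n * 6)
          ≡⟨ collect n ⟩
        2 + n * 14 ∎
        where
        collect : ∀ n → (1 + n * 8) + (1 + n * 6) ≡ 2 + n * 14
        collect = solve-∀

    potential-start : ∀ Sv → potential (startTargets Sv) ≡ n
    potential-start Sv = trans (unmarked-mark (const false) v refl) (unmarked-none n)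

    -- At the start only S(v) can be nonempty; the bound assumed for it is supplied by
    -- `search-time`.
    invariant-start : ∀ {Sv} → length Sv ≤ n → Invariant (startTargets Sv)
    invariant-start {Sv} Sv≤n = record
      { queue-visited = λ { (here refl) → updateAt-updates v (const false) }
      ; queue-unique  = [] ∷ []
      ; pending-S     = λ {x} x≢v _ → updateAt-minimal x v (const []) x≢v
      ; S-bounded     = bounded
      }
      where
      bounded : ∀ x → length (S (startTargets Sv) x) ≤ n
      bounded x with x ≟ v
      ... | yes refl rewrite updateAt-updates x {const Sv} (const []) = Sv≤n
      ... | no x≢v   rewrite updateAt-minimal x v {const Sv} (const []) x≢v = z≤n

    main-halts : ∀ {Sv} → length Sv ≤ n → ∃ (Loop visitTarget (startTargets Sv))
    main-halts Sv≤n =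
      loop-halts Invariant potential visitTarget-progress (invariant-start Sv≤n)

    main-time : ∀ {Sv l a} → length Sv ≤ n → Loop visitTarget (startTargets Sv) (l , a) →
                l ≤ 1 + n * (4 + n * 14)
    main-time {Sv} Sv≤n run = subst (λ m → _ ≤ 1 + m * (4 + n * 14)) (potential-start Sv)
      (proj₁ (loop-time Invariant potential visitTarget-progress (invariant-start Sv≤n) run))

    -- Running time of the whole algorithm

    algorithm-halts : ∃ Runs
    algorithm-halts with [ ω′uv ] ≤⁺? d u v
    ... | no ω′≰d  = _ , skip ω′≰d
    ... | yes ω′≤d with search-halts
    ... | _ , search = _ , update ω′≤d search (proj₂ (main-halts (proj₂ (search-time search))))

    algorithm-time : ∀ {k a} → Runs (k , a) → k ≤ 41 * n ^ 2
    -- The `3 * n + 1` operations are padded to the bound for the other case, so that the same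
    -- estimate applies.
    algorithm-time (skip _) = ≤-trans
      (≤-trans (m≤m+n _ _) (≤-reflexive (pad n))) (quadratic-dominates n u)
      where
      pad : ∀ n → (3 * n + 1) + (10 + 8 * n + 19 * (n * n)) ≡ 11 + 11 * n + 19 * (n * n)
      pad = solve-∀
    algorithm-time (update {k} {l} _ search main)
      with search-time search
    ... | k≤ , Sv≤n = begin
      3 * n + 1 + (2 + k + 1) + 1 + (4 + l)
        ≤⟨ +-mono-≤ (+-monoˡ-≤ 1 (+-monoʳ-≤ (3 * n + 1) (+-monoˡ-≤ 1 (+-monoʳ-≤ 2 k≤))))
                    (+-monoʳ-≤ 4 (main-time Sv≤n main)) ⟩
      3 * n + 1 + (2 + (1 + n * (4 + n * 5)) + 1) + 1 + (4 + (1 + n * (4 + n * 14)))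
        ≡⟨ collect n ⟩
      -- The linear term collects 3 for the initialisation and 4 for each loop, the quadratic one 5
      -- for the search and 14 for the main loop.
      11 + 11 * n + 19 * (n * n)
        ≤⟨ quadratic-dominates n u ⟩
      41 * n ^ 2 ∎
      where
      open ≤-Reasoning
      collect : ∀ n →
        3 * n + 1 + (2 + (1 + n * (4 + n * 5)) + 1) + 1 + (4 + (1 + n * (4 + n * 14)))
        ≡ 11 + 11 * n + 19 * (n * n)
      collect = solve-∀

mainTheorem4 :
    ∀ {c ℓ₁ ℓ₂} (W : Weights c ℓ₁ ℓ₂) → let open APSP W in
    ∃[ C ] (∀ {n} (G : Graph n) (u v : Fin n) (ω′uv : Weights.Carrier W) →
      IsUpdate G u v ω′uv →
      (d : Vector (Vector Length n) n) (σ : Vector (Vector ℕ n) n) →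
      IsAPSP G d σ →
      let open Graph G
          open AlgorithmA G u v ω′uv d σ in
      ∃ Runs
      × (∀ {k a} → Runs (k , a) → k ≤ C * n ^ 2)
      × (∀ (G′ : Graph n) → IsUpdated G u v ω′uv G′ →
         (d′ : Vector (Vector Length n) n) (σ′ : Vector (Vector ℕ n) n) →
         IsAPSP G′ d′ σ′ →
         let open Affected d d′ σ σ′ in
         (∀ {k a} → Runs (k , a) → ∀ y → y ∈ T u → ∣ S (State.p a y) ∣ ≤ C * n)
         × ∥ T u ∥ ≤ C * (n + m)
         × ∥ S v ∥ ≤ C * (n + m)))
mainTheorem4 W = 41 , λ G u v ω′uv _ d σ _ →
    algorithm-halts W G u v ω′uv d σ
  , algorithm-time W G u v ω′uv d σ
  , λ G′ _ d′ σ′ _ →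
      -- These linear bounds already hold with factor 1; `m≤n*m` relaxes it to 41, the constant that
      -- the quadratic bound requires.
      (λ _ _ _ → ≤-trans (∣p∣≤n (Affected.S d d′ σ σ′ _)) (m≤n*m _ 41))
    , ≤-trans (extendedSize≤ W G _) (m≤n*m _ 41)
    , ≤-trans (extendedSize≤ W G _) (m≤n*m _ 41)
  where open APSP W
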